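{- Let $\pi = 1 \oplus \rho$, where $\rho$ is a sum-indecomposable permutation that starts with an ascent (i.e. $\rho(1)<\rho(2)$). If $\rho$ has no increasing bond, or $\rho$ has no decreasing bond, then the class $\operatorname{Av}(\pi)$ is not deflatable.
   Context: A permutation $\alpha$ is contained in $\beta$ if $\beta$ has a subsequence in the same relative order as $\alpha$; a class is a set of permutations closed under taking contained permutations; $\operatorname{Av}(\pi)$ is the class of permutations not containing $\pi$. $\alpha\oplus\beta$ is the permutation consisting of a copy of $\alpha$ followed by a copy of $\beta$ whose entries are all larger than those of the copy of $\alpha$; a permutation is sum-indecomposable if it is not of the form $\alpha\oplus\beta$ with $\alpha,\beta$ nonempty. A bond of a permutation is a pair of entries in adjacent positions whose values differ by $1$; it is increasing if they form the pattern $12$ and decreasing if they form the pattern $21$. An interval of a permutation is a set of entries whose positions and values each form a set of consecutive integers, the whole permutation not counting as an interval; a permutation is simple if all its intervals are single entries (so $1$, $12$, $21$ are simple). A class $\mathcal{C}$ is deflatable if there is a proper subclass $\mathcal{D}\subsetneq\mathcal{C}$ with $\mathcal{C}\subseteq\langle\mathcal{D}\rangle$, where the substitution closure $\langle\mathcal{D}\rangle$ is the largest class whose simple permutations are exactly those of $\mathcal{D}$; equivalently, $\mathcal{C}$ is not deflatable if and only if every permutation in $\mathcal{C}$ is contained in some simple permutation belonging to $\mathcal{C}$. -}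

module Defs where

open import Level using (suc; zero)
open import Data.Nat as ℕ using (ℕ; _≤_; _+_; _∸_)
open import Data.Nat.Properties using (<⇒≤)
open import Data.Fin as Fin using (Fin; toℕ; fromℕ<; splitAt; join)
open import Data.Fin.Properties using (splitAt-join; join-splitAt)
open import Data.Sum as Sum using (_⊎_; inj₁; inj₂)
open import Data.Sum.Properties using (inj₁-injective; inj₂-injective)
open import Data.Product using (Σ; ∃; _×_; _,_)
open import Function using (_∘_; _⇔_)
open import Function.Definitions using (Injective)
open import Relation.Nullary using (¬_)
open import Relation.Binary.PropositionalEquality using (_≡_; refl; cong; sym; trans; subst)

-- Permutations of length n: injective (hence bijective) maps Fin n → Fin n.
-- Position i (0-based) carries value σ i (0-based).

record Perm : Set where
  constructor perm
  field
    len : ℕ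
    σ   : Fin len → Fin len
    inj : Injective _≡_ _≡_ σ
open Perm public

val : (p : Perm) (i : ℕ) → i ℕ.< len p → ℕ
val p i h = toℕ (σ p (fromℕ< h))

_≼_ : Perm → Perm → Set
α ≼ β = Σ (Fin (len α) → Fin (len β)) λ e →
          (∀ i j → i Fin.< j → e i Fin.< e j) ×
          (∀ i j → (σ α i Fin.< σ α j) ⇔ (σ β (e i) Fin.< σ β (e j)))

IsClass : (Perm → Set) → Set
IsClass C = ∀ α β → α ≼ β → C β → C α

Av : Perm → Perm → Set
Av π β = ¬ (π ≼ β)

_≈_ : Perm → Perm → Set
p ≈ q = Σ (len p ≡ len q) λ e →
          ∀ (i : Fin (len p)) → toℕ (σ p i) ≡ toℕ (σ q (subst Fin e i))

private
  ⊕σ : (α β : Perm) → Fin (len α + len β) → Fin (len α + len β)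
  ⊕σ α β = join (len α) (len β) ∘ Sum.map (σ α) (σ β) ∘ splitAt (len α)

  map-inj : ∀ {A B C D : Set} (f : A → C) (g : B → D) →
            Injective _≡_ _≡_ f → Injective _≡_ _≡_ g →
            Injective _≡_ _≡_ (Sum.map f g)
  map-inj f g fi gi {inj₁ x} {inj₁ y} eq = cong inj₁ (fi (inj₁-injective eq))
  map-inj f g fi gi {inj₁ x} {inj₂ y} ()
  map-inj f g fi gi {inj₂ x} {inj₁ y} ()
  map-inj f g fi gi {inj₂ x} {inj₂ y} eq = cong inj₂ (gi (inj₂-injective eq))

  ⊕inj : (α β : Perm) → Injective _≡_ _≡_ (⊕σ α β)
  ⊕inj α β {x} {y} eq =
    trans (sym (join-splitAt m n x))
      (trans (cong (join m n)
               (map-inj (σ α) (σ β) (inj α) (inj β) {splitAt m x} {splitAt m y}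
                 (trans (sym (splitAt-join m n (Sum.map (σ α) (σ β) (splitAt m x))))
                   (trans (cong (splitAt m) eq)
                     (splitAt-join m n (Sum.map (σ α) (σ β) (splitAt m y)))))))
             (join-splitAt m n y))
    where m = len α
          n = len β

_⊕_ : Perm → Perm → Perm
α ⊕ β = perm (len α + len β) (⊕σ α β) (⊕inj α β)

one : Perm
one = perm 1 (λ i → i) (λ eq → eq)

SumIndecomposable : Perm → Set
SumIndecomposable ρ =
  ¬ (Σ Perm λ α → Σ Perm λ β → 1 ≤ len α × 1 ≤ len β × ρ ≈ (α ⊕ β))

StartsWithAscent : Perm → Set
StartsWithAscent ρ = Σ (2 ≤ len ρ) λ h → val ρ 0 (<⇒≤ h) ℕ.< val ρ 1 h

HasIncreasingBond : Perm → Set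
HasIncreasingBond ρ = Σ ℕ λ i → Σ (ℕ.suc i ℕ.< len ρ) λ h →
  val ρ (ℕ.suc i) h ≡ ℕ.suc (val ρ i (<⇒≤ h))

HasDecreasingBond : Perm → Set
HasDecreasingBond ρ = Σ ℕ λ i → Σ (ℕ.suc i ℕ.< len ρ) λ h →
  val ρ i (<⇒≤ h) ≡ ℕ.suc (val ρ (ℕ.suc i) h)

IsIntervalBlock : (p : Perm) (a b : ℕ) → Set
IsIntervalBlock p a b = Σ ℕ λ c → ∀ (i : Fin (len p)) →
  ((a ≤ toℕ i × toℕ i ≤ b) ⇔ (c ≤ toℕ (σ p i) × toℕ (σ p i) ≤ c + (b ∸ a)))

IsWhole : (p : Perm) (a b : ℕ) → Set
IsWhole p a b = (a ≡ 0) × (ℕ.suc b ≡ len p)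

Simple : Perm → Set
Simple p = 1 ≤ len p ×
  (∀ a b → a ≤ b → b ℕ.< len p → IsIntervalBlock p a b → ¬ IsWhole p a b → a ≡ b)

-- Substitution closure ⟨D⟩: the largest set of permutations closed under
-- containment whose simple members all lie in D, i.e. the permutations all
-- of whose simple subpermutations lie in D.

SubstClosure : (Perm → Set) → Perm → Set
SubstClosure D p = ∀ τ → Simple τ → τ ≼ p → D τ

Deflatable : (Perm → Set) → Set₁
Deflatable C = Σ (Perm → Set) λ D →
  IsClass D × (∀ p → D p → C p) × (Σ Perm λ p → C p × ¬ D p) ×
  (∀ p → C p → SubstClosure D p)

{-# OPTIONS --safe #-}

-- It suffices to extend every α avoiding π = 1 ⊕ ρ to a simple permutation avoiding π.
-- Start from α ⊕ 1, which avoids π because ρ is sum-indecomposable, and whose first entry lies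
-- below its last one.  Let I be a proper interval with at least two entries, and m its leftmost
-- entry.  We insert an entry right after m, cutting I, such that π is still avoided.
--   * If an entry lies to the left of and below m, let μ be the lowest entry up to m and insert
--     the new entry just below μ.  It could only serve as the 1 of π, where μ would do as well.
--   * Otherwise let y be the leftmost entry to the right of and above I; it exists because the
--     first entry lies below the last one.  Insert a copy of y just above or just below y.
--     Entries strictly between m and y are below y and below all entries left of m.  Hence an
--     occurrence of π using the copy has no entry between m and y: either its 1 is left of m,
--     or its 1 is m, the copy is ρ(1), and ρ(2) > ρ(1) is not to the left of y.  So y can
--     replace the copy, unless both are used; then they form a bond of ρ.  If ρ has no
--     decreasing bond, place the copy above y.  If ρ has no increasing bond, place it below y,
--     except when no entry outside I lies between I and y by value: then place it above, since
--     the 1 of an occurrence using both must be m, so that the bond would contradict ρ(1) < ρ(2).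
-- In both cases some entry outside I separates the new entry from I by value, so that every
-- interval containing I gets strictly larger, and the new entry forms a bond with no other one.
-- Repeating this for the interval spanned by each pair of the initial entries terminates, and
-- then all intervals are trivial.

module Submission where

open import Defs
open import Data.Sum as Sum using (_⊎_; inj₁; inj₂; [_,_]′)
open import Relation.Nullary using (¬_; Dec; yes; no; contradiction; ¬?; _×-dec_)
open import Relation.Nullary.Decidable using (does; dec-true; dec-false; decidable-stable; ¬¬-excluded-middle)
open import Relation.Unary using (Decidable)
open import Relation.Binary using (tri<; tri≈; tri>)
open import Relation.Binary.PropositionalEquality
open import Data.Empty using (⊥; ⊥-elim)
open import Data.Bool using (true)
open import Data.Product using (Σ; ∃; ∃₂; _×_; _,_; proj₁; proj₂)
open import Data.Nat as ℕ using (ℕ; zero; suc; _+_; _*_; _∸_; _≤_; _<_; _<?_; _≤?_; s≤s; z≤n; s<s⁻¹; s≤s⁻¹)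
open import Data.Nat.Properties
open import Data.Nat.Induction using (<-wellFounded)
open import Induction.WellFounded using (Acc; acc)
open import Data.Fin as Fin using (Fin; toℕ; fromℕ<; punchIn; punchOut; splitAt; _↑ˡ_; _↑ʳ_)
import Data.Fin.Properties as Fin
open import Data.Fin.Subset using (Subset; ∣_∣)
import Data.Fin.Subset.Properties as Subset
open import Data.Vec as Vec using ()
open import Data.Vec.Properties using (lookup∘tabulate; []=⇒lookup; lookup⇒[]=)
open import Data.List using (List; []; _∷_; allFin; cartesianProduct)
open import Data.List.Membership.Propositional using (_∈_)
open import Data.List.Membership.Propositional.Properties using (∈-allFin; ∈-cartesianProduct⁺)
open import Data.List.Relation.Unary.Any using (here; there)
open import Function using (_∘_; id; case_of_; mk⇔)
open import Function.Bundles using (Equivalence)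
open import Function.Definitions using (Injective)

open Equivalence using (to; from)

-- Monotone maps, minima and ranks on finite sets.

module _ {A : Set} {f g : A → ℕ} (f-inj : Injective _≡_ _≡_ f)
         (mono : ∀ {i j} → f i < f j → g i < g j) where

  mono⇒injective : Injective _≡_ _≡_ g
  mono⇒injective {i} {j} eq with <-cmp (f i) (f j)
  ... | tri< i<j _ _ = contradiction eq (<⇒≢ (mono i<j))
  ... | tri≈ _ i≡j _ = f-inj i≡j
  ... | tri> _ _ j<i = contradiction (sym eq) (<⇒≢ (mono j<i))

  mono⇒cancel : ∀ {i j} → g i < g j → f i < f j
  mono⇒cancel {i} {j} gi<gj with <-cmp (f i) (f j)
  ... | tri< i<j _ _ = i<j
  ... | tri≈ _ i≡j _ = contradiction (cong g (f-inj i≡j)) (<⇒≢ gi<gj)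
  ... | tri> _ _ j<i = contradiction (mono j<i) (<-asym gi<gj)

minimum : ∀ {n} {A : Fin n → Set} → Decidable A → (f : Fin n → ℕ) → ∃ A →
          ∃ λ i → A i × (∀ j → A j → f i ≤ f j)
minimum {n} {A} A? f (i , a) = go i a (<-wellFounded (f i))
  where
  go : ∀ i → A i → Acc _<_ (f i) → ∃ λ i → A i × (∀ j → A j → f i ≤ f j)
  go i a (acc rs) with Fin.any? (λ j → A? j ×-dec f j <? f i)
  ... | yes (j , b , j<i) = go j b (rs j<i)
  ... | no ∄j = i , a , λ j b → ≮⇒≥ λ j<i → ∄j (j , b , j<i)

-- Lets membership in an inductively generated hull be treated as decidable. The double negation
-- does no harm, since the final goal is a negation.
¬¬-decidable : ∀ {n} (A : Fin n → Set) → ¬ ¬ Decidable A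
¬¬-decidable {zero} A k = k λ ()
¬¬-decidable {suc n} A k = ¬¬-excluded-middle λ d → ¬¬-decidable (A ∘ Fin.suc) λ ds →
  k λ { Fin.zero → d ; (Fin.suc i) → ds i }

injective⇒surjective : ∀ {n} {f : Fin n → Fin n} → Injective _≡_ _≡_ f → ∀ j → ∃ λ i → f i ≡ j
injective⇒surjective {suc n} {f} f-inj j with Fin.any? (λ i → f i Fin.≟ j)
... | yes found = found
... | no missed = contradiction (Fin.injective⇒≤ punch-inj) 1+n≰n
  where
  avoid : ∀ i → j ≢ f i
  avoid i j≡fi = missed (i , sym j≡fi)
  punch-inj : Injective _≡_ _≡_ (λ i → punchOut (avoid i))
  punch-inj eq = f-inj (Fin.punchOut-injective (avoid _) (avoid _) eq)

module _ {n : ℕ} (f : Fin n → ℕ) where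

  smaller : Fin n → Subset n
  smaller i = Vec.tabulate λ j → does (f j <? f i)

  private
    ∈smaller : ∀ {i j} → f j < f i → smaller i Vec.[ j ]= true
    ∈smaller {i} {j} j<i = lookup⇒[]= j _
      (trans (lookup∘tabulate _ j) (dec-true (f j <? f i) j<i))

    ∈smaller⁻ : ∀ {i j} → smaller i Vec.[ j ]= true → f j < f i
    ∈smaller⁻ {i} {j} j∈ = decidable-stable (f j <? f i) λ j≮i →
      case trans (sym (dec-false (f j <? f i) j≮i))
        (trans (sym (lookup∘tabulate (λ j → does (f j <? f i)) j)) ([]=⇒lookup j∈)) of λ ()

  -- The standardisation of `f`. The bound holds because `i` is missing from `smaller i`.
  rank : Fin n → Fin n
  rank i = fromℕ< {∣ smaller i ∣} (subst (∣ smaller i ∣ <_) (Subset.∣⊤∣≡n n)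
    (Subset.p⊂q⇒∣p∣<∣q∣ ((λ _ → Subset.∈⊤) , i , Subset.∈⊤ , λ i∈ → <-irrefl refl (∈smaller⁻ i∈))))

  rank-mono : ∀ {i j} → f i < f j → rank i Fin.< rank j
  rank-mono {i} {j} i<j = subst₂ _<_ (sym (Fin.toℕ-fromℕ< _)) (sym (Fin.toℕ-fromℕ< _))
    (Subset.p⊂q⇒∣p∣<∣q∣ ((λ k∈ → ∈smaller (<-trans (∈smaller⁻ k∈) i<j)) ,
      i , ∈smaller i<j , λ i∈ → <-irrefl refl (∈smaller⁻ i∈)))

module _ {n : ℕ} {f : Fin n → ℕ} (f-inj : Injective _≡_ _≡_ f) where

  rank-cancel : ∀ {i j} → rank f i Fin.< rank f j → f i < f j
  rank-cancel = mono⇒cancel f-inj (rank-mono f)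

  rank-injective : Injective _≡_ _≡_ (rank f)
  rank-injective = mono⇒injective f-inj (rank-mono f) ∘ cong toℕ

-- Plots, hulls and embeddings.

-- Coordinates need only be distinct, which keeps insertions simple; ranks are taken once, at the
-- end. The invariant `first<last` yields a point above and to the right of a hull when `grow` needs
-- one.
record Plot : Set where
  field
    size : ℕ
    X Y : Fin size → ℕ
    X-inj : Injective _≡_ _≡_ X
    Y-inj : Injective _≡_ _≡_ Y
    first last : Fin size
    first-min : ∀ i → X first ≤ X i
    last-max : ∀ i → X i ≤ X last
    first<last : Y first < Y last
open Plot

Point : Plot → Set
Point P = Fin (size P)

≤∧≢ : ∀ {n} {f : Fin n → ℕ} → Injective _≡_ _≡_ f → ∀ {i j} → f i ≤ f j → i ≢ j → f i < f j
≤∧≢ f-inj i≤j i≢j = ≤∧≢⇒< i≤j (i≢j ∘ f-inj)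

-- The points of the smallest interval containing a and b.
data Hull (P : Plot) (a b : Point P) : Point P → Set where
  left  : Hull P a b a
  right : Hull P a b b
  betweenX : ∀ {i j k} → Hull P a b i → Hull P a b k → X P i < X P j → X P j < X P k → Hull P a b j
  betweenY : ∀ {i j k} → Hull P a b i → Hull P a b k → Y P i < Y P j → Y P j < Y P k → Hull P a b j

hull-⊆ : ∀ {P a b c d} → Hull P a b c → Hull P a b d → ∀ {i} → Hull P c d i → Hull P a b i
hull-⊆ c d left = c
hull-⊆ c d right = d
hull-⊆ c d (betweenX i k p q) = betweenX (hull-⊆ c d i) (hull-⊆ c d k) p q
hull-⊆ c d (betweenY i k p q) = betweenY (hull-⊆ c d i) (hull-⊆ c d k) p q

-- Two points suffice: all others lie horizontally between the first and the last one.
Full : (P : Plot) → Point P → Point P → Set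
Full P a b = Hull P a b (first P) × Hull P a b (last P)

full⇒all : ∀ {P a b} → Full P a b → ∀ i → Hull P a b i
full⇒all {P} (f , l) i with first P Fin.≟ i | i Fin.≟ last P
... | yes refl | _ = f
... | no _ | yes refl = l
... | no f≢i | no i≢l =
  betweenX f l (≤∧≢ (X-inj P) (first-min P i) f≢i) (≤∧≢ (X-inj P) (last-max P i) i≢l)

record _⟶_ (P Q : Plot) : Set where
  field
    ι : Point P → Point Q
    ι-X : ∀ {i j} → X P i < X P j → X Q (ι i) < X Q (ι j)
    ι-Y : ∀ {i j} → Y P i < Y P j → Y Q (ι i) < Y Q (ι j)
    ι-first : ι (first P) ≡ first Q
    ι-last : ι (last P) ≡ last Q
    -- Makes every interval of Q contain an interval spanned by two points of P.
    twin-free : ∀ {u v} → u ≢ v → ∃₂ λ i j → i ≢ j × Hull Q u v (ι i) × Hull Q u v (ι j)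
open _⟶_

ι-hull : ∀ {P Q} (e : P ⟶ Q) {a b i} → Hull P a b i → Hull Q (ι e a) (ι e b) (ι e i)
ι-hull e left = left
ι-hull e right = right
ι-hull e (betweenX i k p q) = betweenX (ι-hull e i) (ι-hull e k) (ι-X e p) (ι-X e q)
ι-hull e (betweenY i k p q) = betweenY (ι-hull e i) (ι-hull e k) (ι-Y e p) (ι-Y e q)

ι-full : ∀ {P Q} (e : P ⟶ Q) {a b} → Full P a b → Full Q (ι e a) (ι e b)
ι-full e (f , l) = subst (Hull _ _ _) (ι-first e) (ι-hull e f) , subst (Hull _ _ _) (ι-last e) (ι-hull e l)

ι-injective : ∀ {P Q} (e : P ⟶ Q) → Injective _≡_ _≡_ (ι e)
ι-injective {P} {Q} e = mono⇒injective (X-inj P) (ι-X e) ∘ cong (X Q)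

⟶-refl : ∀ {P} → P ⟶ P
⟶-refl = record
  { ι = id ; ι-X = id ; ι-Y = id ; ι-first = refl ; ι-last = refl
  ; twin-free = λ u≢v → _ , _ , u≢v , left , right }

⟶-trans : ∀ {P Q R} → P ⟶ Q → Q ⟶ R → P ⟶ R
⟶-trans d e = record
  { ι = ι e ∘ ι d
  ; ι-X = ι-X e ∘ ι-X d
  ; ι-Y = ι-Y e ∘ ι-Y d
  ; ι-first = trans (cong (ι e) (ι-first d)) (ι-first e)
  ; ι-last = trans (cong (ι e) (ι-last d)) (ι-last e)
  ; twin-free = λ u≢v →
      let _ , _ , i≢j , hi , hj = twin-free e u≢v
          i , j , i≢j , hi′ , hj′ = twin-free d i≢j
      in i , j , i≢j , hull-⊆ hi hj (ι-hull e hi′) , hull-⊆ hi hj (ι-hull e hj′)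
  }

-- Inserting a point.

-- Doubling makes room for a new coordinate 2 * g in front of the old coordinates ≥ g.
opaque

  old : ℕ → ℕ
  old a = suc (2 * a)

  gap : ℕ → ℕ
  gap g = 2 * g

  old-mono : ∀ {a b} → a < b → old a < old b
  old-mono a<b = s≤s (*-monoʳ-< 2 a<b)

  old-mono-≤ : ∀ {a b} → a ≤ b → old a ≤ old b
  old-mono-≤ a≤b = s≤s (*-monoʳ-≤ 2 a≤b)

  old-cancel : ∀ {a b} → old a < old b → a < b
  old-cancel {a} {b} p = *-cancelˡ-< 2 a b (s<s⁻¹ p)

  old-injective : ∀ {a b} → old a ≡ old b → a ≡ b
  old-injective {a} {b} eq = *-cancelˡ-≡ a b 2 (suc-injective eq)

  old<gap : ∀ {a g} → a < g → old a < gap g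
  old<gap {a} {g} a<g = subst (_≤ gap g) (cong suc (+-suc a (a + 0))) (*-monoʳ-≤ 2 a<g)

  gap<old : ∀ {a g} → g ≤ a → gap g < old a
  gap<old g≤a = s≤s (*-monoʳ-≤ 2 g≤a)

  old<gap⁻ : ∀ {a g} → old a < gap g → a < g
  old<gap⁻ p = ≰⇒> λ g≤a → <-asym p (gap<old g≤a)

  gap<old⁻ : ∀ {a g} → gap g < old a → g ≤ a
  gap<old⁻ p = ≮⇒≥ λ a<g → <-asym p (old<gap a<g)

gap≢old : ∀ {a g} → gap g ≢ old a
gap≢old {a} {g} eq with <-≤-connex a g
... | inj₁ a<g = <⇒≢ (old<gap a<g) (sym eq)
... | inj₂ g≤a = <⇒≢ (gap<old g≤a) eq

extend : ∀ {n} → ℕ → (Fin n → ℕ) → Fin (suc n) → ℕ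
extend g f Fin.zero = gap g
extend g f (Fin.suc i) = old (f i)

extend-injective : ∀ {n g} {f : Fin n → ℕ} → Injective _≡_ _≡_ f → Injective _≡_ _≡_ (extend g f)
extend-injective f-inj {Fin.zero} {Fin.zero} eq = refl
extend-injective f-inj {Fin.zero} {Fin.suc j} eq = contradiction eq gap≢old
extend-injective f-inj {Fin.suc i} {Fin.zero} eq = contradiction (sym eq) gap≢old
extend-injective f-inj {Fin.suc i} {Fin.suc j} eq = cong Fin.suc (f-inj (old-injective eq))

module Insert (P : Plot) (g h : ℕ) (first<g : X P (first P) < g) (g≤last : g ≤ X P (last P)) where

  insert : Plot
  insert = record
    { size = suc (size P)
    ; X = extend g (X P)
    ; Y = extend h (Y P)
    ; X-inj = extend-injective (X-inj P)
    ; Y-inj = extend-injective (Y-inj P)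
    ; first = Fin.suc (first P)
    ; last = Fin.suc (last P)
    ; first-min = λ { Fin.zero → <⇒≤ (old<gap first<g) ; (Fin.suc i) → old-mono-≤ (first-min P i) }
    ; last-max = λ { Fin.zero → <⇒≤ (gap<old g≤last) ; (Fin.suc i) → old-mono-≤ (last-max P i) }
    ; first<last = old-mono (first<last P)
    }

  -- The new point cuts the interval hull of a and b between m and w, and e separates
  -- it from that interval.
  module _ {a b m w e : Point P} (I? : Decidable (Hull P a b))
           (m∈ : Hull P a b m) (w∈ : Hull P a b w) (m<g : X P m < g) (g≤w : g ≤ X P w)
           (e∉ : ¬ Hull P a b e)
           (sep : ∀ {i} → Hull P a b i → ∀ {c d} →
                  Hull insert c d Fin.zero → Hull insert c d (Fin.suc i) → Hull insert c d (Fin.suc e)) where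

    private
      -- For `i` in the hull of `a` and `b` the second old point is the separator `e`. Otherwise `i`
      -- lies left of `m` or right of `w`, and that point is then horizontally between `i` and the
      -- new one.
      twin : ∀ i → ∃ λ j → i ≢ j × (∀ {c d} →
             Hull insert c d Fin.zero → Hull insert c d (Fin.suc i) → Hull insert c d (Fin.suc j))
      twin i with I? i
      ... | yes i∈ = e , (λ { refl → e∉ i∈ }) , sep i∈
      ... | no i∉ with <-≤-connex (X P i) g
      ...   | inj₁ i<g = m , (λ { refl → i∉ m∈ }) , λ hz hi → betweenX hi hz (old-mono i<m) (old<gap m<g)
        where
        i<m : X P i < X P m
        i<m = ≤∧≢ (X-inj P) (≮⇒≥ λ m<i → i∉ (betweenX m∈ w∈ m<i (<-≤-trans i<g g≤w))) λ { refl → i∉ m∈ }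
      ...   | inj₂ g≤i = w , (λ { refl → i∉ w∈ }) , λ hz hi → betweenX hz hi (gap<old g≤w) (old-mono w<i)
        where
        w<i : X P w < X P i
        w<i = ≤∧≢ (X-inj P) (≮⇒≥ λ i<w → i∉ (betweenX m∈ w∈ (<-≤-trans m<g g≤i) i<w)) λ { refl → i∉ w∈ }

    insert-⟶ : P ⟶ insert
    insert-⟶ = record
      { ι = Fin.suc ; ι-X = old-mono ; ι-Y = old-mono ; ι-first = refl ; ι-last = refl ; twin-free = free }
      where
      free : ∀ {u v} → u ≢ v → ∃₂ λ i j → i ≢ j × Hull insert u v (Fin.suc i) × Hull insert u v (Fin.suc j)
      free {Fin.zero} {Fin.zero} u≢v = contradiction refl u≢v
      free {Fin.zero} {Fin.suc i} _ = let j , i≢j , h = twin i in i , j , i≢j , right , h left right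
      free {Fin.suc i} {Fin.zero} _ = let j , i≢j , h = twin i in i , j , i≢j , left , h right left
      free {Fin.suc i} {Fin.suc j} u≢v = i , j , u≢v ∘ cong Fin.suc , left , right

    insert-∈ : Hull insert (Fin.suc a) (Fin.suc b) Fin.zero
    insert-∈ = betweenX (ι-hull insert-⟶ m∈) (ι-hull insert-⟶ w∈) (old<gap m<g) (gap<old g≤w)

    insert-absorbs : Hull insert (Fin.suc a) (Fin.suc b) (Fin.suc e)
    insert-absorbs = sep m∈ insert-∈ (ι-hull insert-⟶ m∈)

-- Occurrences of `one ⊕ ρ` in a plot.

record Occurrence (ρ : Perm) (P : Plot) : Set where
  field
    root : Point P
    emb : Fin (len ρ) → Point P
    emb-X : ∀ {i j} → i Fin.< j → X P (emb i) < X P (emb j)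
    emb-Y : ∀ {i j} → σ ρ i Fin.< σ ρ j → Y P (emb i) < Y P (emb j)
    root-X : ∀ j → X P root < X P (emb j)
    root-Y : ∀ j → Y P root < Y P (emb j)
open Occurrence

-- Points are given up to an equation, so that later proofs can match on whether they are new or
-- old.
module At {ρ : Perm} {P : Plot} (o : Occurrence ρ P) where

  emb-X-at : ∀ {i j u v} → emb o i ≡ u → emb o j ≡ v → i Fin.< j → X P u < X P v
  emb-X-at refl refl = emb-X o

  emb-Y-at : ∀ {i j u v} → emb o i ≡ u → emb o j ≡ v → σ ρ i Fin.< σ ρ j → Y P u < Y P v
  emb-Y-at refl refl = emb-Y o

  root-X-at : ∀ {j r v} → root o ≡ r → emb o j ≡ v → X P r < X P v
  root-X-at refl refl = root-X o _

  root-Y-at : ∀ {j r v} → root o ≡ r → emb o j ≡ v → Y P r < Y P v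
  root-Y-at refl refl = root-Y o _

  emb-X-cancel : ∀ {i j u v} → emb o i ≡ u → emb o j ≡ v → X P u < X P v → i Fin.< j
  emb-X-cancel refl refl = mono⇒cancel Fin.toℕ-injective (emb-X o)

  emb-Y-cancel : ∀ {i j u v} → emb o i ≡ u → emb o j ≡ v → Y P u < Y P v → σ ρ i Fin.< σ ρ j
  emb-Y-cancel refl refl = mono⇒cancel (inj ρ ∘ Fin.toℕ-injective) (emb-Y o)

module _ {ρ : Perm} (P : Plot) {g h : ℕ} {first<g : X P (first P) < g} {g≤last : g ≤ X P (last P)} where

  private
    Q : Plot
    Q = Insert.insert P g h first<g g≤last

  -- Only the root has to change when no entry of `ρ` is the new point. Heights are compared only to
  -- the right of `m`, so that `m` itself never has to be compared.
  replace-root : (o : Occurrence ρ Q) → (∀ j → emb o j ≢ Fin.zero) → ∀ {r} → root o ≡ r → ∀ m →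
    (∀ x → X Q r < old (X P x) → X P m < X P x) →
    (∀ x → X P m < X P x → Y Q r < old (Y P x) → Y P m < Y P x) → Occurrence ρ P
  replace-root o ≢new root≡ m m-X m-Y = record
    { root = m
    ; emb = proj₁ ∘ emb-old
    ; emb-X = λ i<j → old-cancel (emb-X-at (proj₂ (emb-old _)) (proj₂ (emb-old _)) i<j)
    ; emb-Y = λ i<j → old-cancel (emb-Y-at (proj₂ (emb-old _)) (proj₂ (emb-old _)) i<j)
    ; root-X = m<
    ; root-Y = λ j → m-Y _ (m< j) (root-Y-at root≡ (proj₂ (emb-old j)))
    }
    where
    open At o
    emb-old : ∀ j → ∃ λ x → emb o j ≡ Fin.suc x
    emb-old j with emb o j in eq
    ... | Fin.zero = contradiction eq (≢new j)
    ... | Fin.suc x = x , refl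
    m< : ∀ j → X P m < X P (proj₁ (emb-old j))
    m< j = m-X _ (root-X-at root≡ (proj₂ (emb-old j)))

-- If the new point were an entry of `ρ`, the root would be an old point to its left, hence no lower
-- than `μ` and so above the new point. A new root gives way to `μ`, the next point upwards, which
-- is further left.
insert-minimum : ∀ {ρ} P {g μ first<g g≤last} → X P μ < g → (∀ i → X P i < g → Y P μ ≤ Y P i) →
  Occurrence ρ (Insert.insert P g (Y P μ) first<g g≤last) → Occurrence ρ P
insert-minimum {ρ} P {g} {μ} μ<g μ-min o = by-root (root o) refl
  where
  open At o
  by-root : ∀ r → root o ≡ r → Occurrence ρ P
  by-root Fin.zero root≡ = replace-root P o (λ j j≡ → <-irrefl refl (root-X-at root≡ j≡)) root≡ μ
    (λ x p → <-≤-trans μ<g (gap<old⁻ p))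
    (λ x μ<x p → ≤∧≢ (Y-inj P) (gap<old⁻ p) λ { refl → <-irrefl refl μ<x })
  by-root (Fin.suc r) root≡ = replace-root P o
    (λ j j≡ → <⇒≱ (old<gap⁻ (root-Y-at root≡ j≡)) (μ-min r (old<gap⁻ (root-X-at root≡ j≡))))
    root≡ r (λ x → old-cancel) (λ x _ → old-cancel)

-- Trading the copy of a point for the original.

NoIncreasingBond NoDecreasingBond : Perm → Set
NoIncreasingBond ρ = ∀ {i j : Fin (len ρ)} → toℕ j ≡ suc (toℕ i) → toℕ (σ ρ j) ≢ suc (toℕ (σ ρ i))
NoDecreasingBond ρ = ∀ {i j : Fin (len ρ)} → toℕ j ≡ suc (toℕ i) → toℕ (σ ρ i) ≢ suc (toℕ (σ ρ j))

-- Heights for a copy of y inserted right after m, with the reason why the copy and y cannot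
-- both be entries of ρ: they would form a bond or, for above-unless, an initial descent,
-- since the root is then m itself.
data Beside (ρ : Perm) (P : Plot) (m y : Point P) : ℕ → Set where
  above  : NoDecreasingBond ρ → Beside ρ P m y (suc (Y P y))
  below : NoIncreasingBond ρ → Beside ρ P m y (Y P y)
  above-unless : (∀ i → X P i < X P m → Y P y < Y P i) → Beside ρ P m y (suc (Y P y))

-- The copy and `y` are neighbours by height, so every point other than `y` compares alike with
-- both.
beside-< : ∀ {ρ P m y h} → Beside ρ P m y h → ∀ {x} → x ≢ y → Y P x < h → Y P x < Y P y
beside-< {P = P} (above _) x≢y x<h = ≤∧≢ (Y-inj P) (s≤s⁻¹ x<h) x≢y
beside-< {P = P} (above-unless _) x≢y x<h = ≤∧≢ (Y-inj P) (s≤s⁻¹ x<h) x≢y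
beside-< (below _) x≢y x<h = x<h

beside-> : ∀ {ρ P m y h} → Beside ρ P m y h → ∀ {x} → y ≢ x → h ≤ Y P x → Y P y < Y P x
beside-> (above _) y≢x h≤x = h≤x
beside-> (above-unless _) y≢x h≤x = h≤x
beside-> {P = P} (below _) y≢x h≤x = ≤∧≢ (Y-inj P) h≤x y≢x

beside-≤ : ∀ {ρ P m y h} → Beside ρ P m y h → Y P y ≤ h
beside-≤ (above _) = n≤1+n _
beside-≤ (above-unless _) = n≤1+n _
beside-≤ (below _) = ≤-refl

-- Surjectivity of `σ ρ` locates the value just above `σ ρ i`, which would lie strictly between
-- unless it is `σ ρ j`.
no-value-between : ∀ (ρ : Perm) {i j} → σ ρ i Fin.< σ ρ j →
  (∀ l → σ ρ i Fin.< σ ρ l → ¬ σ ρ l Fin.< σ ρ j) → toℕ (σ ρ j) ≡ suc (toℕ (σ ρ i))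
no-value-between ρ {i} {j} i<j none with m≤n⇒m<n∨m≡n i<j
... | inj₂ eq = sym eq
... | inj₁ i+1<j =
  let v<len = <-trans i+1<j (Fin.toℕ<n (σ ρ j))
      l , σl≡ = injective⇒surjective (inj ρ) (fromℕ< v<len)
      σl≡ℕ = trans (cong toℕ σl≡) (Fin.toℕ-fromℕ< v<len)
  in contradiction (subst (_< toℕ (σ ρ j)) (sym σl≡ℕ) i+1<j)
    (none l (subst (toℕ (σ ρ i) <_) (sym σl≡ℕ) ≤-refl))

no-index-between : ∀ {n} {i j : Fin n} → i Fin.< j →
  (∀ l → i Fin.< l → ¬ l Fin.< j) → toℕ j ≡ suc (toℕ i)
no-index-between {n} i<j none = no-value-between (perm n id id) i<j none

module _ {k : ℕ} {τ : Fin (suc (suc k)) → Fin (suc (suc k))}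
         (τ-inj : Injective _≡_ _≡_ τ) (ascent : τ Fin.zero Fin.< τ (Fin.suc Fin.zero)) where

  private
    ρ : Perm
    ρ = perm (suc (suc k)) τ τ-inj

  -- The last two hypotheses keep points strictly between `m` and `y` out of occurrences that use
  -- the copy as an entry of `ρ`: `mid<r` when the root is left of `m`, `mid<y` when the root is
  -- `m`.
  insert-beside : ∀ P {m y h first<g g≤last} → Beside ρ P m y h →
    X P m < X P y → Y P m < Y P y →
    (∀ x → X P m < X P x → X P x < X P y → Y P x < Y P y) →
    (∀ r x → X P r < X P m → X P m < X P x → X P x < X P y → Y P x < Y P r) →
    Occurrence ρ (Insert.insert P (suc (X P m)) h first<g g≤last) → Occurrence ρ P
  insert-beside P {m} {y} {h} {first<g} {g≤last} beside m<y-X m<y-Y mid<y mid<r o = by-root (root o) refl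
    where
    open At o
    Q : Plot
    Q = Insert.insert P (suc (X P m)) h first<g g≤last

    by-root : ∀ r → root o ≡ r → Occurrence ρ P
    -- A copy serving as root gives way to `m`, which is immediately to its left and lower.
    by-root Fin.zero root≡ = replace-root P o (λ j j≡ → <-irrefl refl (root-X-at root≡ j≡)) root≡ m
      (λ x → gap<old⁻)
      (λ x _ p → <-≤-trans m<y-Y (≤-trans (beside-≤ beside) (gap<old⁻ p)))
    by-root (Fin.suc r) root≡ = record
      { root = r
      ; emb = retract ∘ emb o
      ; emb-X = λ i<j → retract-X refl refl (emb-X o i<j)
      ; emb-Y = λ i<j → retract-Y refl refl (emb-Y o i<j)
      ; root-X = λ j → r<X refl (root-X-at root≡ refl)
      ; root-Y = λ j → r<Y refl (root-X-at root≡ refl) (root-Y-at root≡ refl)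
      }
      where
      retract : Point Q → Point P
      retract Fin.zero = y
      retract (Fin.suc x) = x

      r≢y : X P r ≤ X P m → r ≢ y
      r≢y r≤m refl = <⇒≱ m<y-X r≤m

      r<X : ∀ {j u} → emb o j ≡ u → old (X P r) < X Q u → X P r < X P (retract u)
      r<X {u = Fin.zero} _ p = ≤-<-trans (s≤s⁻¹ (old<gap⁻ p)) m<y-X
      r<X {u = Fin.suc x} _ p = old-cancel p

      r<Y : ∀ {j u} → emb o j ≡ u → old (X P r) < X Q u → old (Y P r) < Y Q u → Y P r < Y P (retract u)
      r<Y {u = Fin.zero} _ p q = beside-< {P = P} beside (r≢y (s≤s⁻¹ (old<gap⁻ p))) (old<gap⁻ q)
      r<Y {u = Fin.suc x} _ p q = old-cancel q

      module _ {i} (new : emb o i ≡ Fin.zero) where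

        r≤m : X P r ≤ X P m
        r≤m = s≤s⁻¹ (old<gap⁻ (root-X-at root≡ new))

        -- Together with `r≤m` the assumption makes `m` the root. No old point lies horizontally
        -- between `m` and the copy, so no entry of `ρ` precedes the copy.
        new-first : X P m ≤ X P r → ∀ {i′} → i ≡ Fin.suc i′ → ⊥
        new-first m≤r refl = by-emb (emb o Fin.zero) refl
          where
          by-emb : ∀ u → emb o Fin.zero ≡ u → ⊥
          by-emb Fin.zero eq = <-irrefl refl (emb-X-at eq new (s≤s z≤n))
          by-emb (Fin.suc x) eq = <⇒≱ (old-cancel (root-X-at root≡ eq))
            (≤-trans (s≤s⁻¹ (old<gap⁻ (emb-X-at eq new (s≤s z≤n)))) m≤r)

        -- The copy is the first entry of `ρ`, so the initial ascent puts the second one above it,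
        -- whereas points strictly between `m` and `y` lie below `y`.
        second : X P m ≤ X P r → ∃ λ w → emb o (Fin.suc Fin.zero) ≡ Fin.suc w × X P y ≤ X P w × h ≤ Y P w
        second m≤r = by-index i new refl
          where
          by-index : ∀ i′ → emb o i′ ≡ Fin.zero → i ≡ i′ →
            ∃ λ w → emb o (Fin.suc Fin.zero) ≡ Fin.suc w × X P y ≤ X P w × h ≤ Y P w
          by-index (Fin.suc i′) _ eq = ⊥-elim (new-first m≤r eq)
          by-index Fin.zero new₀ _ with emb o (Fin.suc Fin.zero) in eq
          ... | Fin.zero = ⊥-elim (<-irrefl refl (emb-X-at new₀ eq (s≤s z≤n)))
          ... | Fin.suc w = w , refl , y≤w , h≤w
            where
            h≤w : h ≤ Y P w
            h≤w = gap<old⁻ (emb-Y-at new₀ eq ascent)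
            y≤w : X P y ≤ X P w
            y≤w with w Fin.≟ y
            ... | yes refl = ≤-refl
            ... | no w≢y = ≮⇒≥ λ w<y → <-asym
              (beside-> {P = P} beside (w≢y ∘ sym) h≤w)
              (mid<y w (gap<old⁻ (emb-X-at new₀ eq (s≤s z≤n))) w<y)

        -- The first entry of `ρ` is the copy, the second is not left of `y`, and the others follow
        -- the second.
        later : X P m ≤ X P r → ∀ {j x} → emb o j ≡ Fin.suc x → X P m < X P x → X P y ≤ X P x
        later m≤r {Fin.zero} j≡ m<x = ⊥-elim (by-index i refl)
          where
          by-index : ∀ i′ → i ≡ i′ → ⊥
          by-index (Fin.suc i′) eq = new-first m≤r eq
          by-index Fin.zero refl = case trans (sym j≡) new of λ ()
        later m≤r {Fin.suc Fin.zero} j≡ m<x with w , eq , y≤w , _ ← second m≤r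
          with refl ← trans (sym j≡) eq = y≤w
        later m≤r {Fin.suc (Fin.suc j)} j≡ m<x with w , eq , y≤w , _ ← second m≤r =
          ≤-trans y≤w (<⇒≤ (old-cancel (emb-X-at eq j≡ (s≤s (s≤s z≤n)))))

        none-between : ∀ {j x} → emb o j ≡ Fin.suc x → X P m < X P x → X P y ≤ X P x
        none-between {j} {x} j≡ m<x with <-≤-connex (X P r) (X P m)
        -- A root left of `m` is higher than every point strictly between `m` and `y`.
        ... | inj₁ r<m = ≮⇒≥ λ x<y → <-asym (old-cancel (root-Y-at root≡ j≡)) (mid<r r x r<m m<x x<y)
        ... | inj₂ m≤r = later m≤r j≡ m<x

        -- An entry at an index in between would be an old point strictly between `m` and `y`.
        consecutive : ∀ {j} → emb o j ≡ Fin.suc y → toℕ j ≡ suc (toℕ i)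
        consecutive {j} j≡ = no-index-between (emb-X-cancel new j≡ (gap<old m<y-X)) λ l i<l l<j →
          by-emb l i<l l<j (emb o l) refl
          where
          by-emb : ∀ l → i Fin.< l → l Fin.< j → ∀ u → emb o l ≡ u → ⊥
          by-emb l i<l l<j Fin.zero eq = <-irrefl refl (emb-X-at new eq i<l)
          by-emb l i<l l<j (Fin.suc x) eq = <⇒≱ (old-cancel (emb-X-at eq j≡ l<j))
            (none-between eq (gap<old⁻ (emb-X-at new eq i<l)))

        not-both : ∀ {j} → emb o j ≢ Fin.suc y
        not-both j≡ = by-side beside refl
          where
          by-side : ∀ {h′} → Beside ρ P m y h′ → h ≡ h′ → ⊥
          by-side (above no-dec) refl = no-dec (consecutive j≡) (no-value-between ρ
            (emb-Y-cancel j≡ new (old<gap ≤-refl)) λ l j<l l<i → by-emb l j<l l<i (emb o l) refl)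
            where
            by-emb : ∀ l → _ → _ → ∀ u → emb o l ≡ u → ⊥
            by-emb l j<l l<i Fin.zero eq = <-irrefl refl (emb-Y-at eq new l<i)
            by-emb l j<l l<i (Fin.suc x) eq = <⇒≱ (old-cancel (emb-Y-at j≡ eq j<l))
              (s≤s⁻¹ (old<gap⁻ (emb-Y-at eq new l<i)))
          by-side (below no-inc) refl = no-inc (consecutive j≡) (no-value-between ρ
            (emb-Y-cancel new j≡ (gap<old ≤-refl)) λ l i<l l<j → by-emb l i<l l<j (emb o l) refl)
            where
            by-emb : ∀ l → _ → _ → ∀ u → emb o l ≡ u → ⊥
            by-emb l i<l l<j Fin.zero eq = <-irrefl refl (emb-Y-at new eq i<l)
            by-emb l i<l l<j (Fin.suc x) eq = <⇒≱ (old-cancel (emb-Y-at eq j≡ l<j))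
              (gap<old⁻ (emb-Y-at new eq i<l))
          -- The root cannot be left of `m`, where all points are higher than `y`. So it is `m`, the
          -- copy has index 0, and the entry `w` of index 1 is strictly right of `y`, which leaves
          -- no index for `y`.
          by-side (above-unless y<) refl with <-≤-connex (X P r) (X P m)
          ... | inj₁ r<m = <⇒≱ (y< r r<m) (<⇒≤ (old-cancel (root-Y-at root≡ j≡)))
          ... | inj₂ m≤r =
            let w , w≡ , y≤w , y<w = second m≤r
                i<j = emb-X-cancel new j≡ (gap<old m<y-X)
                j<1 = emb-X-cancel j≡ w≡ (old-mono (≤∧≢ (X-inj P) y≤w λ y≡w → <⇒≢ y<w (cong (Y P) y≡w)))
            in n≮0 (<-≤-trans i<j (s≤s⁻¹ j<1))

      retract-X : ∀ {i j u v} → emb o i ≡ u → emb o j ≡ v → X Q u < X Q v → X P (retract u) < X P (retract v)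
      retract-X {u = Fin.zero} {Fin.zero} _ _ p = contradiction p (<-irrefl refl)
      retract-X {u = Fin.zero} {Fin.suc x} i≡ j≡ p = ≤∧≢ (X-inj P) (none-between i≡ j≡ (gap<old⁻ p))
        λ { refl → not-both i≡ j≡ }
      retract-X {u = Fin.suc x} {Fin.zero} _ _ p = ≤-<-trans (s≤s⁻¹ (old<gap⁻ p)) m<y-X
      retract-X {u = Fin.suc x} {Fin.suc x′} _ _ p = old-cancel p

      retract-Y : ∀ {i j u v} → emb o i ≡ u → emb o j ≡ v → Y Q u < Y Q v → Y P (retract u) < Y P (retract v)
      retract-Y {u = Fin.zero} {Fin.zero} _ _ p = contradiction p (<-irrefl refl)
      retract-Y {u = Fin.zero} {Fin.suc x} i≡ j≡ p = beside-> {P = P} beside (λ { refl → not-both i≡ j≡ }) (gap<old⁻ p)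
      retract-Y {u = Fin.suc x} {Fin.zero} i≡ j≡ p = beside-< {P = P} beside (λ { refl → not-both j≡ i≡ }) (old<gap⁻ p)
      retract-Y {u = Fin.suc x} {Fin.suc x′} _ _ p = old-cancel p

-- One growth step for a hull.

-- By `cover` no new point is outside the grown hull, and `absorbed` has moved inside. Hence the
-- number of points outside drops.
record Growth (ρ : Perm) (P : Plot) (a b : Point P) : Set where
  field
    grown : Plot
    embed : P ⟶ grown
    avoids : ¬ Occurrence ρ grown
    cover : ∀ u → Hull grown (ι embed a) (ι embed b) u ⊎ ∃ λ i → u ≡ ι embed i
    absorbed : Point P
    absorbed∉ : ¬ Hull P a b absorbed
    absorbed∈ : Hull grown (ι embed a) (ι embed b) (ι embed absorbed)

module _ {k : ℕ} {τ : Fin (suc (suc k)) → Fin (suc (suc k))}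
         (τ-inj : Injective _≡_ _≡_ τ) (ascent : τ Fin.zero Fin.< τ (Fin.suc Fin.zero)) where

  private
    ρ : Perm
    ρ = perm (suc (suc k)) τ τ-inj

  grow : NoIncreasingBond ρ ⊎ NoDecreasingBond ρ → ∀ P → ¬ Occurrence ρ P → ∀ {a b} → a ≢ b →
    Decidable (Hull P a b) → ¬ Full P a b → Growth ρ P a b
  grow bonds P avoids {a} {b} a≢b I? ¬full =
    by-corner (Fin.any? (λ u → X P u <? X P m ×-dec Y P u <? Y P m))
    where
    I : Point P → Set
    I = Hull P a b

    leftmost : ∃ λ m → I m × (∀ j → I j → X P m ≤ X P j)
    leftmost = minimum I? (X P) (a , left)

    m : Point P
    m = proj₁ leftmost
    m∈ : I m
    m∈ = proj₁ (proj₂ leftmost)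
    m-min : ∀ {j} → I j → X P m ≤ X P j
    m-min = proj₂ (proj₂ leftmost) _

    -- Ensures that the column right after `m` cuts the hull.
    other : ∃ λ w → I w × X P m < X P w
    other with a Fin.≟ m
    ... | yes a≡m = b , right , ≤∧≢ (X-inj P) (m-min right) λ m≡b → a≢b (trans a≡m m≡b)
    ... | no a≢m = a , left , ≤∧≢ (X-inj P) (m-min left) (a≢m ∘ sym)

    m<w = proj₂ (proj₂ other)

    first<g : X P (first P) < suc (X P m)
    first<g = s≤s (first-min P m)
    m<last : X P m < X P (last P)
    m<last = <-≤-trans m<w (last-max P _)

    module _ (h : ℕ) where
      open Insert P (suc (X P m)) h first<g m<last

      -- Shared by all cases, which differ in the height `h`, the separator `e` and the reason why
      -- `ρ` is still avoided.
      growth : ∀ {e} → ¬ I e →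
        (∀ {i} → I i → ∀ {c d} →
          Hull insert c d Fin.zero → Hull insert c d (Fin.suc i) → Hull insert c d (Fin.suc e)) →
        (Occurrence ρ insert → Occurrence ρ P) → Growth ρ P a b
      growth e∉ sep harmless = record
        { embed = insert-⟶ I? m∈ (proj₁ (proj₂ other)) ≤-refl m<w e∉ sep
        ; avoids = avoids ∘ harmless
        ; cover = λ where
            Fin.zero → inj₁ (insert-∈ I? m∈ (proj₁ (proj₂ other)) ≤-refl m<w e∉ sep)
            (Fin.suc i) → inj₂ (i , refl)
        ; absorbed∉ = e∉
        ; absorbed∈ = insert-absorbs I? m∈ (proj₁ (proj₂ other)) ≤-refl m<w e∉ sep
        }

    m≢ : ∀ {e} → ¬ I e → e ≢ m
    m≢ e∉ refl = e∉ m∈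

    -- Hulls are convex by height, so an outside point above one of their points is above all of
    -- them.
    above-I : ∀ {e} → ¬ I e → Y P m < Y P e → ∀ {i} → I i → Y P i < Y P e
    above-I e∉ m<e i∈ = ≤∧≢ (Y-inj P) (≮⇒≥ λ e<i → e∉ (betweenY m∈ i∈ m<e e<i)) λ { refl → e∉ i∈ }

    below-I : ∀ {e} → ¬ I e → Y P e < Y P m → ∀ {i} → I i → Y P e < Y P i
    below-I e∉ e<m i∈ = ≤∧≢ (Y-inj P) (≮⇒≥ λ i<e → e∉ (betweenY i∈ m∈ i<e e<m)) λ { refl → e∉ i∈ }

    by-corner : Dec (∃ λ u → X P u < X P m × Y P u < Y P m) → Growth ρ P a b
    by-corner (yes (u , u<m-X , u<m-Y)) =
      let μ , μ≤m , μ-min = minimum (λ i → X P i ≤? X P m) (Y P) (m , ≤-refl)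
          μ<m-Y = ≤-<-trans (μ-min u (<⇒≤ u<m-X)) u<m-Y
          μ<m-X = ≤∧≢ (X-inj P) μ≤m (λ μ≡m → <⇒≢ μ<m-Y (cong (Y P) μ≡m))
          μ∉ = λ μ∈ → <⇒≱ μ<m-X (m-min μ∈)
      -- The separator is `μ` itself: just above the new point and below the hull.
      in growth (Y P μ) μ∉
           (λ i∈ hz hi → betweenY hz hi (gap<old ≤-refl) (old-mono (below-I μ∉ μ<m-Y i∈)))
           (insert-minimum P (s≤s μ≤m) λ i i<g → μ-min i (s≤s⁻¹ i<g))
    by-corner (no ∄u) = by-bonds bonds
      where
      left⇒above : ∀ {i} → X P i < X P m → Y P m < Y P i
      left⇒above i<m = ≤∧≢ (Y-inj P) (≮⇒≥ λ i<m′ → ∄u (_ , i<m , i<m′)) λ { refl → <-irrefl refl i<m }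

      left⇒∉ : ∀ {i} → X P i < X P m → ¬ I i
      left⇒∉ i<m i∈ = <⇒≱ i<m (m-min i∈)

      UpperRight : Point P → Set
      UpperRight i = ¬ I i × X P m < X P i × Y P m < Y P i

      -- If the hull contains the first point, it misses the last one, which is higher. If not, the
      -- first point is left of `m`, hence above it, and the still higher last point cannot be in
      -- the hull without enclosing the first by height.
      last-upperRight : UpperRight (last P)
      last-upperRight with I? (first P)
      ... | yes first∈ = last∉ , m<last ,
        ≤∧≢ (Y-inj P) (≮⇒≥ λ last<m → last∉ (betweenY first∈ m∈ (first<last P) last<m)) (m≢ last∉ ∘ sym)
        where
        last∉ : ¬ I (last P)
        last∉ last∈ = ¬full (first∈ , last∈)
      ... | no first∉ = (λ last∈ → first∉ (betweenY m∈ last∈ m<first (first<last P))) , m<last ,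
        <-trans m<first (first<last P)
        where
        m<first : Y P m < Y P (first P)
        m<first = left⇒above (≤∧≢ (X-inj P) (first-min P m) (m≢ first∉))

      upperRight : ∃ λ y → UpperRight y × (∀ j → UpperRight j → X P y ≤ X P j)
      upperRight = minimum (λ i → ¬? (I? i) ×-dec X P m <? X P i ×-dec Y P m <? Y P i)
        (X P) (last P , last-upperRight)

      y : Point P
      y = proj₁ upperRight
      y∉ : ¬ I y
      y∉ = proj₁ (proj₁ (proj₂ upperRight))
      m<y-X : X P m < X P y
      m<y-X = proj₁ (proj₂ (proj₁ (proj₂ upperRight)))
      m<y-Y : Y P m < Y P y
      m<y-Y = proj₂ (proj₂ (proj₁ (proj₂ upperRight)))

      between : ∀ {x} → ¬ I x → X P m < X P x → X P x < X P y → Y P x < Y P m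
      between {x} x∉ m<x x<y = ≤∧≢ (Y-inj P)
        (≮⇒≥ λ m<x′ → <⇒≱ x<y (proj₂ (proj₂ upperRight) x (x∉ , m<x , m<x′))) (m≢ x∉)

      harmless : ∀ {h} → Beside ρ P m y h →
        Occurrence ρ (Insert.insert P (suc (X P m)) h first<g m<last) → Occurrence ρ P
      harmless beside = insert-beside τ-inj ascent P beside m<y-X m<y-Y below-y below-left
        where
        below-y : ∀ x → X P m < X P x → X P x < X P y → Y P x < Y P y
        below-y x m<x x<y with I? x
        ... | yes x∈ = above-I y∉ m<y-Y x∈
        ... | no x∉ = <-trans (between x∉ m<x x<y) m<y-Y
        below-left : ∀ r x → X P r < X P m → X P m < X P x → X P x < X P y → Y P x < Y P r
        below-left r x r<m m<x x<y with I? x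
        ... | yes x∈ = above-I (left⇒∉ r<m) (left⇒above r<m) x∈
        ... | no x∉ = <-trans (between x∉ m<x x<y) (left⇒above r<m)

      above-y : Beside ρ P m y (suc (Y P y)) → Growth ρ P a b
      -- With the copy above `y`, the point `y` itself separates it from the hull.
      above-y beside = growth (suc (Y P y)) y∉
        (λ i∈ hz hi → betweenY hi hz (old-mono (above-I y∉ m<y-Y i∈)) (old<gap ≤-refl)) (harmless beside)

      by-bonds : NoIncreasingBond ρ ⊎ NoDecreasingBond ρ → Growth ρ P a b
      by-bonds (inj₂ no-dec) = above-y (above no-dec)
      -- With the copy below `y`, the separator must lie strictly between the hull and `y` by
      -- height.
      by-bonds (inj₁ no-inc) with Fin.any? (λ e → ¬? (I? e) ×-dec Y P m <? Y P e ×-dec Y P e <? Y P y)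
      ... | yes (e , e∉ , m<e , e<y) = growth (Y P y) e∉
        (λ i∈ hz hi → betweenY hi hz (old-mono (above-I e∉ m<e i∈)) (old<gap e<y)) (harmless (below no-inc))
      -- Points left of `m` are outside the hull and above `m`. With no separator below `y`, they
      -- are all above `y`, as `above-unless` requires.
      ... | no ∄e = above-y (above-unless λ i i<m → ≤∧≢ (Y-inj P)
        (≮⇒≥ λ i<y → ∄e (i , left⇒∉ i<m , left⇒above i<m , i<y)) λ { refl → <-asym i<m m<y-X })

  -- Iterating growth until every hull is everything.

  private
    Avoiding : (P : Plot) → (∀ {Q} → P ⟶ Q → Set) → Set
    Avoiding P A = ∃ λ Q → Σ (P ⟶ Q) λ e → ¬ Occurrence ρ Q × A e

  -- Induction on the length `n` of a list covering all points outside the hull: each growth step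
  -- removes the absorbed point from it.
  fill : NoIncreasingBond ρ ⊎ NoDecreasingBond ρ → ∀ n P → ¬ Occurrence ρ P → ∀ {a b} → a ≢ b →
    (missing : Fin n → Point P) → (∀ u → Hull P a b u ⊎ ∃ λ j → u ≡ missing j) →
    ¬ ¬ Avoiding P (λ {Q} e → Full Q (ι e a) (ι e b))
  fill bonds n P avoids {a} {b} a≢b missing cover ret =
    ¬¬-decidable (Hull P a b) λ I? → by-full n missing cover I? (I? (first P) ×-dec I? (last P))
    where
    by-full : ∀ n (missing : Fin n → Point P) → (∀ u → Hull P a b u ⊎ ∃ λ j → u ≡ missing j) →
      Decidable (Hull P a b) → Dec (Full P a b) → ⊥
    by-full _ _ _ _ (yes full) = ret (P , ⟶-refl , avoids , full)
    by-full n missing cover I? (no ¬full) with grow bonds P avoids a≢b I? ¬full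
    ... | G with cover (Growth.absorbed G)
    -- The absorbed point was outside the hull, so it is listed; in particular the list is not
    -- empty.
    ...   | inj₁ c∈ = Growth.absorbed∉ G c∈
    by-full (suc n) missing cover I? (no ¬full) | G | inj₂ (j , c≡) =
      fill bonds n grown G.avoids (a≢b ∘ ι-injective embed) (ι embed ∘ missing ∘ punchIn j) cover′
        λ (Q , e , Q-avoids , full) → ret (Q , ⟶-trans embed e , Q-avoids , full)
      where
      module G = Growth G
      open G using (grown; embed)
      cover′ : ∀ u → Hull grown (ι embed a) (ι embed b) u ⊎ ∃ λ l → u ≡ ι embed (missing (punchIn j l))
      cover′ u with G.cover u
      ... | inj₁ u∈ = inj₁ u∈
      ... | inj₂ (i , refl) with cover i
      ...   | inj₁ i∈ = inj₁ (ι-hull embed i∈)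
      ...   | inj₂ (l , refl) with j Fin.≟ l
      ...     | yes refl = inj₁ (subst (Hull grown _ _ ∘ ι embed) c≡ G.absorbed∈)
      ...     | no j≢l = inj₂ (punchOut j≢l , cong (ι embed ∘ missing) (sym (Fin.punchIn-punchOut j≢l)))

  -- Pairs can be treated one after the other because fullness survives later insertions, by
  -- `ι-full`.
  fill-list : NoIncreasingBond ρ ⊎ NoDecreasingBond ρ → ∀ P → ¬ Occurrence ρ P →
    (pairs : List (Point P × Point P)) →
    ¬ ¬ Avoiding P (λ {Q} e → ∀ {a b} → (a , b) ∈ pairs → a ≢ b → Full Q (ι e a) (ι e b))
  fill-list bonds P avoids [] ret = ret (P , ⟶-refl , avoids , λ ())
  fill-list bonds P avoids ((a , b) ∷ pairs) ret =
    fill-list bonds P avoids pairs λ (Q , e , Q-avoids , full) → case a Fin.≟ b of λ where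
      (yes refl) → ret (Q , e , Q-avoids , λ where
        (here refl) a≢a → contradiction refl a≢a
        (there ∈pairs) → full ∈pairs)
      (no a≢b) → fill bonds (size Q) Q Q-avoids (a≢b ∘ ι-injective e) id (λ u → inj₂ (u , refl))
        λ (R , d , R-avoids , ab-full) → ret (R , ⟶-trans e d , R-avoids , λ where
          (here refl) _ → ab-full
          (there ∈pairs) a≢b → ι-full d (full ∈pairs a≢b))

  -- By `twin-free` every hull of two distinct points contains the hull of two initial ones, so the
  -- pairs created by insertions need no treatment of their own.
  saturate : NoIncreasingBond ρ ⊎ NoDecreasingBond ρ → ∀ P → ¬ Occurrence ρ P →
    ¬ ¬ Avoiding P (λ {Q} e → ∀ {u v} → u ≢ v → ∀ i → Hull Q u v i)
  saturate bonds P avoids ret =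
    fill-list bonds P avoids (cartesianProduct (allFin (size P)) (allFin (size P)))
      λ (Q , e , Q-avoids , full) → ret (Q , e , Q-avoids , λ u≢v i →
        let a , b , a≢b , ha , hb = twin-free e u≢v
        in hull-⊆ ha hb (full⇒all (full (∈-cartesianProduct⁺ (∈-allFin a) (∈-allFin b)) a≢b) i))

-- From plots back to permutations.

module Standardise (P : Plot) where

  column row : Point P → Fin (size P)
  column = rank (X P)
  row = rank (Y P)

  point : Fin (size P) → Point P
  point i = proj₁ (injective⇒surjective (rank-injective (X-inj P)) i)

  column-point : ∀ i → column (point i) ≡ i
  column-point i = proj₂ (injective⇒surjective (rank-injective (X-inj P)) i)

  point-column : ∀ u → point (column u) ≡ u
  point-column u = rank-injective (X-inj P) (column-point (column u))

  point-injective : Injective _≡_ _≡_ point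
  point-injective eq = trans (sym (column-point _)) (trans (cong column eq) (column-point _))

  standard : Perm
  standard = perm (size P) (row ∘ point) (point-injective ∘ rank-injective (Y-inj P))

  occurrence : ∀ {ρ} → (one ⊕ ρ) ≼ standard → Occurrence ρ P
  occurrence {ρ} (e , e-mono , e-σ) = record
    { root = point (e Fin.zero)
    ; emb = λ j → point (e (Fin.suc j))
    ; emb-X = λ i<j → point-X (e-mono _ _ (s≤s i<j))
    ; emb-Y = λ i<j → rank-cancel (Y-inj P) (to (e-σ _ _) (s≤s i<j))
    ; root-X = λ j → point-X (e-mono _ _ (s≤s z≤n))
    ; root-Y = λ j → rank-cancel (Y-inj P) (to (e-σ _ _) (s≤s z≤n))
    }
    where
    point-X : ∀ {i j} → i Fin.< j → X P (point i) < X P (point j)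
    point-X {i} {j} i<j = rank-cancel (X-inj P) (subst₂ Fin._<_ (sym (column-point i)) (sym (column-point j)) i<j)

  ≼-standard : ∀ {β} (q : Fin (len β) → Point P) →
    (∀ {i j} → i Fin.< j → X P (q i) < X P (q j)) →
    (∀ {i j} → σ β i Fin.< σ β j → Y P (q i) < Y P (q j)) → β ≼ standard
  ≼-standard {β} q q-X q-Y = column ∘ q , (λ i j i<j → rank-mono (X P) (q-X i<j)) , λ i j → mk⇔
    (λ i<j → subst₂ Fin._<_ (sym (row-q i)) (sym (row-q j)) (rank-mono (Y P) (q-Y i<j)))
    (λ i<j → cancel (rank-cancel (Y-inj P) (subst₂ Fin._<_ (row-q i) (row-q j) i<j)))
    where
    row-q : ∀ i → row (point (column (q i))) ≡ row (q i)
    row-q i = cong row (point-column (q i))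
    cancel : ∀ {i j} → Y P (q i) < Y P (q j) → σ β i Fin.< σ β j
    cancel = mono⇒cancel (inj β ∘ Fin.toℕ-injective) q-Y

  -- A block with `a < b` contains two points and is convex in columns and in rows, so it contains
  -- their hull, which is everything.
  simple : (∀ {u v} → u ≢ v → ∀ i → Hull P u v i) → Simple standard
  simple full = size>0 , λ a b a≤b b<n block ¬whole →
    [ (λ a<b → ⊥-elim (¬whole (whole a<b b<n block))) , id ]′ (m≤n⇒m<n∨m≡n a≤b)
    where
    size>0 : 1 ≤ size P
    size>0 = ≤-<-trans z≤n (Fin.toℕ<n (first P))

    whole : ∀ {a b} → a < b → b < size P → IsIntervalBlock standard a b → IsWhole standard a b
    whole {a} {b} a<b b<n (c , block) =
      n≤0⇒n≡0 (subst (a ≤_) (Fin.toℕ-fromℕ< size>0) (proj₁ (all (fromℕ< size>0)))) ,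
      ≤-antisym b<n (subst (_≤ suc b) (suc-pred (size P) {{ℕ.>-nonZero size>0}})
        (s≤s (subst (_≤ b) (Fin.toℕ-fromℕ< pred<) (proj₂ (all (fromℕ< pred<))))))
      where
      pred< : ℕ.pred (size P) < size P
      pred< = subst (_≤ size P) (sym (suc-pred (size P) {{ℕ.>-nonZero size>0}})) ≤-refl

      Block : Fin (size P) → Set
      Block i = a ≤ toℕ i × toℕ i ≤ b

      pa pb : Fin (size P)
      pa = fromℕ< (<-trans a<b b<n)
      pb = fromℕ< b<n
      pa≡ = Fin.toℕ-fromℕ< (<-trans a<b b<n)
      pb≡ = Fin.toℕ-fromℕ< b<n

      rows : ∀ {u} → Block (column u) → c ≤ toℕ (row u) × toℕ (row u) ≤ c + (b ∸ a)
      rows {u} u∈ =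
        subst (λ v → c ≤ toℕ (row v) × toℕ (row v) ≤ c + (b ∸ a)) (point-column u) (to (block _) u∈)

      rows⁻ : ∀ {u} → c ≤ toℕ (row u) × toℕ (row u) ≤ c + (b ∸ a) → Block (column u)
      rows⁻ {u} u∈ = from (block _)
        (subst (λ v → c ≤ toℕ (row v) × toℕ (row v) ≤ c + (b ∸ a)) (sym (point-column u)) u∈)

      convex : ∀ {u} → Hull P (point pa) (point pb) u → Block (column u)
      convex left = subst Block (sym (column-point pa)) (≤-reflexive (sym pa≡) , subst (_≤ b) (sym pa≡) (<⇒≤ a<b))
      convex right = subst Block (sym (column-point pb)) (subst (a ≤_) (sym pb≡) (<⇒≤ a<b) , ≤-reflexive pb≡)
      convex (betweenX i k i<j j<k) =
        ≤-trans (proj₁ (convex i)) (<⇒≤ (rank-mono (X P) i<j)) ,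
        ≤-trans (<⇒≤ (rank-mono (X P) j<k)) (proj₂ (convex k))
      convex (betweenY i k i<j j<k) = rows⁻
        (≤-trans (proj₁ (rows (convex i))) (<⇒≤ (rank-mono (Y P) i<j)) ,
         ≤-trans (<⇒≤ (rank-mono (Y P) j<k)) (proj₂ (rows (convex k))))

      all : ∀ i → Block i
      all i = subst Block (column-point i) (convex (full pa≢pb (point i)))
        where
        pa≢pb : point pa ≢ point pb
        pa≢pb eq = <⇒≢ a<b (trans (sym pa≡) (trans (cong toℕ (point-injective eq)) pb≡))

-- The initial plot.

-- The index `t` is the last one and carries the largest value, so `τ` fixes it; deleting it leaves
-- `α` with `τ` equal to `α ⊕ one`.
decomposable : ∀ {n m} (eq : n ≡ m + 1) → 1 ≤ m →
  ∀ {τ : Fin n → Fin n} (τ-inj : Injective _≡_ _≡_ τ) {t : Fin n} →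
  (∀ (l : Fin n) → l Fin.≤ t) → (∀ l → τ l Fin.≤ τ t) → ¬ SumIndecomposable (perm n τ τ-inj)
decomposable {m = m} refl 1≤m {τ} τ-inj {t} t-last t-top indec =
  indec (α , one , 1≤m , ≤-refl , refl , same)
  where
  top : Fin (m + 1)
  top = m ↑ʳ Fin.zero

  toℕ-top : toℕ top ≡ m
  toℕ-top = trans (Fin.toℕ-↑ʳ m Fin.zero) (+-identityʳ m)

  ≤m : ∀ (l : Fin (m + 1)) → toℕ l ≤ m
  ≤m l = s≤s⁻¹ (subst (toℕ l <_) (+-comm m 1) (Fin.toℕ<n l))

  top-unique : ∀ {l} → top Fin.≤ l → l ≡ top
  top-unique {l} top≤l = Fin.toℕ-injective (≤-antisym (subst (toℕ l ≤_) (sym toℕ-top) (≤m l)) top≤l)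

  τ-top : τ top ≡ top
  τ-top = subst (λ l → τ l ≡ top) (top-unique (t-last top))
    (top-unique (let l , τl≡ = injective⇒surjective τ-inj top in subst (Fin._≤ τ t) τl≡ (t-top l)))

  τ< : ∀ i → toℕ (τ (i ↑ˡ 1)) < m
  τ< i = ≤∧≢⇒< (≤m _) λ τi≡m → <⇒≢ (Fin.toℕ<n i) (trans (sym (Fin.toℕ-↑ˡ i 1))
    (trans (cong toℕ (τ-inj (trans (Fin.toℕ-injective (trans τi≡m (sym toℕ-top))) (sym τ-top)))) toℕ-top))

  α : Perm
  α = perm m (λ i → fromℕ< (τ< i)) λ {i} {j} eq → Fin.↑ˡ-injective 1 i j (τ-inj (Fin.toℕ-injective
    (trans (sym (Fin.toℕ-fromℕ< (τ< i))) (trans (cong toℕ eq) (Fin.toℕ-fromℕ< (τ< j))))))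

  same : ∀ i → toℕ (τ i) ≡ toℕ (σ (α ⊕ one) i)
  same i with splitAt m i | Fin.join-splitAt m 1 i
  ... | inj₁ x | refl = sym (trans (Fin.toℕ-↑ˡ (fromℕ< (τ< x)) 1) (Fin.toℕ-fromℕ< (τ< x)))
  ... | inj₂ Fin.zero | refl = cong toℕ τ-top

-- The plot of β ⊕ 1.
plot : ∀ {n} {β : Fin (suc n) → Fin (suc n)} → Injective _≡_ _≡_ β → Plot
plot {n} {β} β-inj = record
  { size = suc (suc n)
  ; X = topped toℕ
  ; Y = topped (toℕ ∘ β)
  ; X-inj = topped-injective id
  ; Y-inj = topped-injective β-inj
  ; first = Fin.suc Fin.zero
  ; last = Fin.zero
  ; first-min = λ _ → z≤n
  ; last-max = λ { Fin.zero → ≤-refl ; (Fin.suc i) → <⇒≤ (Fin.toℕ<n i) }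
  ; first<last = Fin.toℕ<n (β Fin.zero)
  }
  where
  topped : (Fin (suc n) → ℕ) → Fin (suc (suc n)) → ℕ
  topped f Fin.zero = suc n
  topped f (Fin.suc i) = f i
  topped-injective : ∀ {f : Fin (suc n) → Fin (suc n)} → Injective _≡_ _≡_ f → Injective _≡_ _≡_ (topped (toℕ ∘ f))
  topped-injective f-inj {Fin.zero} {Fin.zero} eq = refl
  topped-injective f-inj {Fin.zero} {Fin.suc j} eq = contradiction (sym eq) (<⇒≢ (Fin.toℕ<n _))
  topped-injective f-inj {Fin.suc i} {Fin.zero} eq = contradiction eq (<⇒≢ (Fin.toℕ<n _))
  topped-injective f-inj {Fin.suc i} {Fin.suc j} eq = cong Fin.suc (f-inj (Fin.toℕ-injective eq))

-- The added point is rightmost and topmost. It cannot be the root, and as an entry of `ρ` it would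
-- be last and largest, against indecomposability. Any other occurrence lies in `β`.
plot-avoids : ∀ {k τ} (τ-inj : Injective _≡_ _≡_ τ) → let ρ = perm (suc (suc k)) τ τ-inj in
  SumIndecomposable ρ → ∀ {n β} (β-inj : Injective _≡_ _≡_ β) →
  Av (one ⊕ ρ) (perm (suc n) β β-inj) → ¬ Occurrence ρ (plot β-inj)
plot-avoids {k} {τ} τ-inj indec {n} {β} β-inj av o = by-top (Fin.any? λ j → emb o j Fin.≟ Fin.zero)
  where
  open At o
  ρ : Perm
  ρ = perm (suc (suc k)) τ τ-inj
  P : Plot
  P = plot β-inj

  Y≤top : ∀ u → Y P u ≤ suc n
  Y≤top Fin.zero = ≤-refl
  Y≤top (Fin.suc i) = <⇒≤ (Fin.toℕ<n (β i))

  by-top : Dec (∃ λ j → emb o j ≡ Fin.zero) → ⊥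
  by-top (yes (j , j≡)) = decomposable (cong suc (+-comm 1 k)) (s≤s z≤n) τ-inj {j}
    (λ l → ≮⇒≥ λ j<l → <⇒≱ (emb-X-at j≡ refl j<l) (last-max P (emb o l)))
    (λ l → ≮⇒≥ λ j<l → <⇒≱ (emb-Y-at j≡ refl j<l) (Y≤top (emb o l))) indec
  by-top (no ∄j) = av (proj₁ ∘ e , e-X , λ i j → mk⇔ (e-Y i j)
    (mono⇒cancel (inj (one ⊕ ρ) ∘ Fin.toℕ-injective) (λ {i} {j} → e-Y i j) {i} {j}))
    where
    entry : Fin (suc (suc (suc k))) → Point P
    entry Fin.zero = root o
    entry (Fin.suc j) = emb o j

    entry-X : ∀ i j → i Fin.< j → X P (entry i) < X P (entry j)
    entry-X Fin.zero (Fin.suc j) _ = root-X o j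
    entry-X (Fin.suc i) (Fin.suc j) (s≤s i<j) = emb-X o i<j

    entry-Y : ∀ i j → σ (one ⊕ ρ) i Fin.< σ (one ⊕ ρ) j → Y P (entry i) < Y P (entry j)
    entry-Y Fin.zero (Fin.suc j) _ = root-Y o j
    entry-Y (Fin.suc i) (Fin.suc j) (s≤s i<j) = emb-Y o i<j

    ≢top : ∀ i → entry i ≢ Fin.zero
    ≢top Fin.zero root≡ = <⇒≱ (root-X-at root≡ refl) (last-max P (emb o Fin.zero))
    ≢top (Fin.suc j) j≡ = ∄j (j , j≡)

    e : ∀ i → ∃ λ x → entry i ≡ Fin.suc x
    e i with entry i in eq
    ... | Fin.zero = contradiction eq (≢top i)
    ... | Fin.suc x = x , refl

    e-X : ∀ i j → i Fin.< j → proj₁ (e i) Fin.< proj₁ (e j)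
    e-X i j i<j = subst₂ _<_ (cong (X P) (proj₂ (e i))) (cong (X P) (proj₂ (e j))) (entry-X i j i<j)

    e-Y : ∀ i j → σ (one ⊕ ρ) i Fin.< σ (one ⊕ ρ) j → β (proj₁ (e i)) Fin.< β (proj₁ (e j))
    e-Y i j i<j = subst₂ _<_ (cong (Y P) (proj₂ (e i))) (cong (Y P) (proj₂ (e j))) (entry-Y i j i<j)

-- Bonds, deflatability and simple extensions.

noIncreasingBond : ∀ ρ → ¬ HasIncreasingBond ρ → NoIncreasingBond ρ
noIncreasingBond ρ none {i} {j} j≡ σj≡ = none (toℕ i , i+1<n ,
  trans (cong (toℕ ∘ σ ρ) (Fin.toℕ-injective (trans (Fin.toℕ-fromℕ< i+1<n) (sym j≡))))
    (trans σj≡ (cong (suc ∘ toℕ ∘ σ ρ) (sym (Fin.fromℕ<-toℕ i _)))))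
  where
  i+1<n : suc (toℕ i) < len ρ
  i+1<n = subst (_< len ρ) j≡ (Fin.toℕ<n j)

noDecreasingBond : ∀ ρ → ¬ HasDecreasingBond ρ → NoDecreasingBond ρ
noDecreasingBond ρ none {i} {j} j≡ σi≡ = none (toℕ i , i+1<n ,
  trans (cong (toℕ ∘ σ ρ) (Fin.fromℕ<-toℕ i _))
    (trans σi≡ (cong (suc ∘ toℕ ∘ σ ρ) (sym (Fin.toℕ-injective (trans (Fin.toℕ-fromℕ< i+1<n) (sym j≡)))))))
  where
  i+1<n : suc (toℕ i) < len ρ
  i+1<n = subst (_< len ρ) j≡ (Fin.toℕ<n j)

≼-refl : ∀ α → α ≼ α
≼-refl _ = id , (λ _ _ → id) , λ _ _ → mk⇔ id id

-- A simple `τ` in `C` contains itself, so the closure condition puts it in `D`, and with it every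
-- `α` below it.
simple-extensions⇒not-deflatable : ∀ {C} →
  (∀ α → C α → ¬ ¬ ∃ λ τ → Simple τ × C τ × α ≼ τ) → ¬ Deflatable C
simple-extensions⇒not-deflatable extend (D , D-class , _ , (α , Cα , ¬Dα) , closure) =
  extend α Cα λ (τ , simple , Cτ , α≼τ) → ¬Dα (D-class α τ α≼τ (closure τ Cτ τ simple (≼-refl τ)))

theorem3p3 : (ρ : Perm) → SumIndecomposable ρ → StartsWithAscent ρ →
    (¬ HasIncreasingBond ρ ⊎ ¬ HasDecreasingBond ρ) →
    ¬ Deflatable (Av (one ⊕ ρ))
theorem3p3 ρ@(perm _ τ τ-inj) indec (s≤s (s≤s z≤n) , ascent) no-bonds =
  simple-extensions⇒not-deflatable simple-extension
  where
  bonds : NoIncreasingBond ρ ⊎ NoDecreasingBond ρ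
  bonds = Sum.map (noIncreasingBond ρ) (noDecreasingBond ρ) no-bonds

  simple-extension : ∀ α → Av (one ⊕ ρ) α → ¬ ¬ ∃ λ τ → Simple τ × Av (one ⊕ ρ) τ × α ≼ τ
  -- A plot needs a leftmost entry, so the empty permutation is extended separately, to `one`.
  simple-extension (perm zero _ _) _ ret = ret (one , (≤-refl , one-interval) , one-avoids , (λ ()) , (λ ()) , λ ())
    where
    one-interval : ∀ a b → a ≤ b → b < 1 → IsIntervalBlock one a b → ¬ IsWhole one a b → a ≡ b
    one-interval zero zero _ _ _ _ = refl
    one-interval _ (suc _) _ (s≤s ()) _ _
    one-avoids : Av (one ⊕ ρ) one
    one-avoids (e , e-mono , _) with e Fin.zero | e (Fin.suc Fin.zero) | e-mono Fin.zero (Fin.suc Fin.zero) (s≤s z≤n)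
    ... | Fin.zero | Fin.zero | ()
  simple-extension α@(perm (suc _) _ α-inj) avoids ret =
    saturate τ-inj ascent bonds (plot α-inj) (plot-avoids τ-inj indec α-inj avoids) λ (Q , e , Q-avoids , full) →
      let open Standardise Q
      in ret (standard , simple full , Q-avoids ∘ occurrence ,
              ≼-standard {α} (ι e ∘ Fin.suc) (ι-X e) (ι-Y e))
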